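{- Let $r \ge 1$ be odd, $a \ge 1$ be odd, and $t \ge 1$, $s \ge 0$ be integers. Then $$\sigma(r,s,a,t) \ge \begin{cases} r\left\lceil\frac{rt+s}{a}\right\rceil + (t-1)r+1 & \text{if } t \ge 2, \text{ or } t=1 \text{ and } a<tr+s,\\ r & \text{if } t=1 \text{ and } a \ge r+s.\end{cases}$$
   Context: All graphs are finite simple graphs. A $(d,d+s)$-graph is a graph all of whose vertex degrees lie in $\{d, \ldots, d+s\}$. An $(r,r+a)$-factor of $G$ is a spanning subgraph all of whose degrees lie in $\{r,\ldots,r+a\}$; an $(r,r+a)$-factorization of $G$ with $x$ factors is a decomposition of $E(G)$ into $x$ edge-disjoint $(r,r+a)$-factors. $\sigma(r,s,a,t)$ is the least integer such that, whenever $d \ge \sigma(r,s,a,t)$, every simple $(d,d+s)$-graph has an $(r,r+a)$-factorization with $x$ factors for at least $t$ different values of $x$. -}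

module Defs where

open import Data.Nat using (ℕ; zero; suc; _+_; _*_; _∸_; _≤_; _<_; _/_)
open import Data.Bool using (Bool; true; false; if_then_else_)
open import Data.Fin using (Fin; _≟_)
open import Data.List using (List; map; allFin)
open import Data.Nat.ListAction using (sum)
open import Data.Product using (Σ; ∃; ∃-syntax; _×_)
open import Relation.Nullary using (does)
open import Relation.Binary.PropositionalEquality using (_≡_)
open import Function.Definitions using (Injective)

Odd : ℕ → Set
Odd m = ∃[ k ] m ≡ suc (2 * k)

-- Ceiling division ⌈m / n⌉ (only used with n ≥ 1; value 0 for n = 0).
ceilDiv : ℕ → ℕ → ℕ
ceilDiv m zero = 0
ceilDiv m (suc n) = (m + n) / suc n

record Graph : Set where
  field
    n     : ℕ
    adj   : Fin n → Fin n → Bool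
    sym   : ∀ u v → adj u v ≡ adj v u
    irrefl : ∀ v → adj v v ≡ false
open Graph public

countFin : (n : ℕ) → (Fin n → Bool) → ℕ
countFin n p = sum (map (λ u → if p u then 1 else 0) (allFin n))

degree : (G : Graph) → Fin (n G) → ℕ
degree G v = countFin (n G) (λ u → adj G v u)

IsDDSGraph : ℕ → ℕ → Graph → Set
IsDDSGraph d s G = ∀ v → d ≤ degree G v × degree G v ≤ d + s

-- An edge colouring with x colours, i.e. a decomposition of E(G) into
-- x edge-disjoint spanning subgraphs (colour classes).
record EdgeColouring (G : Graph) (x : ℕ) : Set where
  field
    col    : Fin (n G) → Fin (n G) → Fin x
    colSym : ∀ u v → adj G u v ≡ true → col u v ≡ col v u
open EdgeColouring public

factorDegree : (G : Graph) {x : ℕ} → EdgeColouring G x → Fin x → Fin (n G) → ℕ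
factorDegree G c i v =
  countFin (n G) (λ u → if adj G v u then does (col c v u ≟ i) else false)

IsFactorization : (r a : ℕ) (G : Graph) {x : ℕ} → EdgeColouring G x → Set
IsFactorization r a G {x} c =
  ∀ (i : Fin x) v → r ≤ factorDegree G c i v × factorDegree G c i v ≤ r + a

HasFactorization : (r a : ℕ) → Graph → ℕ → Set
HasFactorization r a G x = Σ (EdgeColouring G x) (IsFactorization r a G)

ManyFactorizations : (r a t : ℕ) → Graph → Set
ManyFactorizations r a t G =
  Σ (Fin t → ℕ) λ f → Injective _≡_ _≡_ f × (∀ j → HasFactorization r a G (f j))

-- D is an admissible threshold: every simple (d,d+s)-graph with d ≥ D has
-- the property.  σ(r,s,a,t) is the least such D.
Threshold : (r s a t D : ℕ) → Set
Threshold r s a t D =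
  ∀ d → D ≤ d → ∀ (G : Graph) → IsDDSGraph d s G → ManyFactorizations r a t G

-- σ(r,s,a,t) ≥ B, stated without presupposing σ exists:
-- every admissible threshold is ≥ B.
SigmaAtLeast : (r s a t B : ℕ) → Set
SigmaAtLeast r s a t B = ∀ D → Threshold r s a t D → B ≤ D

{-# OPTIONS --safe #-}

-- Write q = ⌈(rt + s)/a⌉ and d = r(q + t − 1).  In a (d, d+s)-graph with a vertex
-- of degree d and one of degree d + s, an (r, r+a)-factorization with x factors has
-- rx ≤ d and d + s ≤ (r+a)x, which forces q ≤ x ≤ q + t − 1.  It remains to exclude
-- x = q + t − 1, where every vertex of degree d has degree exactly r in every factor.
-- Let the graph have a set A of odd order, with all degrees d, joined to the rest by
-- at most one edge.  As r is odd, parity makes every factor use an edge leaving A;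
-- but there are at least two factors.  For even d take A = K_{d+1} as a component;
-- for odd d take two copies of a suitable A joined by a bridge; in both cases add
-- a component K_{d+s+1}.  The bound r in the remaining case comes from K_r.
module Submission where

open import Defs
open import Data.Nat using (ℕ; _+_; _*_; _∸_; _≤_; _<_)
open import Data.Product using (_×_)
open import Data.Sum using (_⊎_)
open import Relation.Binary.PropositionalEquality using (_≡_)
open import Algebra.Properties.CommutativeMonoid.Sum using (sum-syntax; sum-cong-≗; ∑-distrib-+; ∑-comm)
open import Data.Bool using (Bool; true; false; _∧_; not; if_then_else_)
open import Data.Fin as Fin using (Fin; zero; suc; _↑ˡ_; _↑ʳ_; splitAt; fromℕ<)
open import Data.Fin.Properties as Fin using (splitAt-↑ˡ; splitAt-↑ʳ; join-splitAt; toℕ-fromℕ<)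
open import Data.List using (tabulate)
open import Data.List.Properties using (map-tabulate)
open import Data.Nat using (zero; suc; s≤s; z≤n; _%_)
open import Data.Nat.Divisibility using (_∣_; divides; ∣m∣n⇒∣m+n; m∣m*n)
open import Data.Nat.DivMod using (m<n*o⇒m/o<n; m≡m%n+[m/n]*n; m%n<n)
open import Data.Nat.ListAction using () renaming (sum to sumˡ)
open import Data.Nat.Primality using (euclidsLemma; prime[2])
open import Data.Nat.Properties
open import Data.Nat.Tactic.RingSolver using (solve-∀)
open import Data.Product using (_,_; proj₁; proj₂; ∃-syntax)
open import Data.Sum using (inj₁; inj₂; [_,_]′)
open import Function using (_∘_; id; const)
open import Function.Definitions using (Injective)
open import Relation.Binary.PropositionalEquality as ≡ using (_≢_; refl; cong; cong₂; subst; trans; _≗_)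
open import Relation.Nullary using (¬_; does; yes; no; contradiction)

-- Finite sums and counting over `Fin k`.

private
  variable
    m k : ℕ

∑ : (k : ℕ) → (Fin k → ℕ) → ℕ
∑ = sum-syntax +-0-commutativeMonoid

∑-cong : {f g : Fin k → ℕ} → f ≗ g → ∑ k f ≡ ∑ k g
∑-cong = sum-cong-≗ +-0-commutativeMonoid

∑-const : ∀ k c → ∑ k (const c) ≡ k * c
∑-const zero    c = refl
∑-const (suc k) c = cong (c +_) (∑-const k c)

∑-mono : {f g : Fin k → ℕ} → (∀ i → f i ≤ g i) → ∑ k f ≤ ∑ k g
∑-mono {zero}  f≤g = z≤n
∑-mono {suc k} f≤g = +-mono-≤ (f≤g zero) (∑-mono (f≤g ∘ suc))

-- If one term exceeded `c`, the others, each at least `c`, would push the sum above `k * c`.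
∑-tight : {f : Fin k → ℕ} (c : ℕ) → (∀ i → c ≤ f i) → ∑ k f ≤ k * c → ∀ i → f i ≡ c
∑-tight {suc k} {f} c c≤f ∑≤ zero = ≤-antisym
  (+-cancelʳ-≤ (k * c) (f zero) c (≤-trans
    (+-monoʳ-≤ (f zero) (subst (_≤ ∑ k (f ∘ suc)) (∑-const k c) (∑-mono (c≤f ∘ suc)))) ∑≤))
  (c≤f zero)
∑-tight {suc k} {f} c c≤f ∑≤ (suc i) = ∑-tight c (c≤f ∘ suc)
  (+-cancelˡ-≤ c _ _ (≤-trans (+-monoˡ-≤ _ (c≤f zero)) ∑≤)) i

∑-split : ∀ m {k} (f : Fin (m + k) → ℕ) →
          ∑ (m + k) f ≡ ∑ m (f ∘ (_↑ˡ k)) + ∑ k (f ∘ (m ↑ʳ_))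
∑-split zero    f = refl
∑-split (suc m) f = trans (cong (f zero +_) (∑-split m (f ∘ suc))) (≡.sym (+-assoc (f zero) _ _))

ind : Bool → ℕ
ind b = if b then 1 else 0

countFin≡∑ : ∀ k (p : Fin k → Bool) → countFin k p ≡ ∑ k (ind ∘ p)
countFin≡∑ k p = trans (cong sumˡ (map-tabulate id (ind ∘ p))) (go k (ind ∘ p))
  where
  go : ∀ k (f : Fin k → ℕ) → sumˡ (tabulate f) ≡ ∑ k f
  go zero    f = refl
  go (suc k) f = cong (f zero +_) (go k (f ∘ suc))

countFin-cong : {p q : Fin k → Bool} → p ≗ q → countFin k p ≡ countFin k q
countFin-cong {k} p≗q = trans (countFin≡∑ k _)
  (trans (∑-cong (cong ind ∘ p≗q)) (≡.sym (countFin≡∑ k _)))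

countFin-split : ∀ m {k} (p : Fin (m + k) → Bool) →
                 countFin (m + k) p ≡ countFin m (p ∘ (_↑ˡ k)) + countFin k (p ∘ (m ↑ʳ_))
countFin-split m {k} p = trans (countFin≡∑ (m + k) p) (trans (∑-split m _)
  (≡.sym (cong₂ _+_ (countFin≡∑ m _) (countFin≡∑ k _))))

countFin-true : ∀ k → countFin k (const true) ≡ k
countFin-true k = trans (countFin≡∑ k _) (trans (∑-const k 1) (*-identityʳ k))

countFin-false : ∀ k → countFin k (const false) ≡ 0
countFin-false k = trans (countFin≡∑ k _) (trans (∑-const k 0) (*-zeroʳ k))

-- Parity and the handshake lemma.

¬2∣odd : ∀ {m} → Odd m → ¬ 2 ∣ m
¬2∣odd (k , refl) (divides q eq) = even≢odd q k (trans (*-comm 2 q) (≡.sym eq))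

-- Induction on the number of vertices: by symmetry the row and the column of vertex `zero`
-- contribute the same amount, its diagonal entry contributes nothing, and the remaining entries
-- form a smaller instance.
handshake : ∀ k (e : Fin k → Fin k → Bool) → (∀ u v → e u v ≡ e v u) → (∀ v → e v v ≡ false) →
            2 ∣ ∑ k (λ u → ∑ k (λ v → ind (e u v)))
handshake zero    e e-sym e-irrefl = divides 0 refl
handshake (suc k) e e-sym e-irrefl = subst (2 ∣_) (≡.sym eq)
  (∣m∣n⇒∣m+n (m∣m*n row) (handshake k _ (λ u v → e-sym (suc u) (suc v)) (e-irrefl ∘ suc)))
  where
  open ≡.≡-Reasoning
  double : ∀ x y → x + (x + y) ≡ 2 * x + y
  double = solve-∀
  row rest : ℕ
  row  = ∑ k (λ v → ind (e zero (suc v)))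
  rest = ∑ k (λ u → ∑ k (λ v → ind (e (suc u) (suc v))))
  eq : ∑ (suc k) (λ u → ∑ (suc k) (λ v → ind (e u v))) ≡ 2 * row + rest
  eq = begin
    (ind (e zero zero) + row) + ∑ k (λ u → ind (e (suc u) zero) + ∑ k (λ v → ind (e (suc u) (suc v))))
      ≡⟨ cong₂ (λ b x → (ind b + row) + x) (e-irrefl zero)
           (∑-distrib-+ +-0-commutativeMonoid (λ u → ind (e (suc u) zero)) _) ⟩
    row + (∑ k (λ u → ind (e (suc u) zero)) + rest)
      ≡⟨ cong (λ x → row + (x + rest)) (∑-cong (λ u → cong ind (e-sym (suc u) zero))) ⟩
    row + (row + rest)
      ≡⟨ double row rest ⟩
    2 * row + rest ∎

-- Gluing two graphs along prescribed cross edges; disjoint unions and joins.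

∀-splitAt : ∀ m {k} {P : Fin (m + k) → Set} →
            (∀ u → P (u ↑ˡ k)) → (∀ w → P (m ↑ʳ w)) → ∀ v → P v
∀-splitAt m {k} {P} l r v = subst P (join-splitAt m k v) (go (splitAt m v))
  where
  go : ∀ x → P (Fin.join m k x)
  go (inj₁ u) = l u
  go (inj₂ w) = r w

module _ (A B : Graph) (c : Fin (n A) → Fin (n B) → Bool) where

  glueAdj : Fin (n A) ⊎ Fin (n B) → Fin (n A) ⊎ Fin (n B) → Bool
  glueAdj (inj₁ u) (inj₁ v) = adj A u v
  glueAdj (inj₁ u) (inj₂ w) = c u w
  glueAdj (inj₂ w) (inj₁ u) = c u w
  glueAdj (inj₂ w) (inj₂ x) = adj B w x

  glueAdj-sym : ∀ x y → glueAdj x y ≡ glueAdj y x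
  glueAdj-sym (inj₁ u) (inj₁ v) = Graph.sym A u v
  glueAdj-sym (inj₁ u) (inj₂ w) = refl
  glueAdj-sym (inj₂ w) (inj₁ u) = refl
  glueAdj-sym (inj₂ w) (inj₂ x) = Graph.sym B w x

  glueAdj-irrefl : ∀ x → glueAdj x x ≡ false
  glueAdj-irrefl (inj₁ u) = Graph.irrefl A u
  glueAdj-irrefl (inj₂ w) = Graph.irrefl B w

  glue : Graph
  glue = record
    { n      = n A + n B
    ; adj    = λ x y → glueAdj (splitAt (n A) x) (splitAt (n A) y)
    ; sym    = λ x y → glueAdj-sym (splitAt (n A) x) (splitAt (n A) y)
    ; irrefl = λ x → glueAdj-irrefl (splitAt (n A) x)
    }

  glue-crossʳ : ∀ u w → adj glue (u ↑ˡ n B) (n A ↑ʳ w) ≡ c u w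
  glue-crossʳ u w = cong₂ glueAdj (splitAt-↑ˡ (n A) u (n B)) (splitAt-↑ʳ (n A) (n B) w)

  degree-glueˡ : ∀ u → degree glue (u ↑ˡ n B) ≡ degree A u + countFin (n B) (c u)
  degree-glueˡ u = trans (countFin-split (n A) _) (cong₂ _+_
    (countFin-cong (λ v → cong₂ glueAdj (splitAt-↑ˡ (n A) u (n B)) (splitAt-↑ˡ (n A) v (n B))))
    (countFin-cong (glue-crossʳ u)))

  degree-glueʳ : ∀ w → degree glue (n A ↑ʳ w) ≡ countFin (n A) (λ u → c u w) + degree B w
  degree-glueʳ w = trans (countFin-split (n A) _) (cong₂ _+_
    (countFin-cong (λ u → cong₂ glueAdj (splitAt-↑ʳ (n A) (n B) w) (splitAt-↑ˡ (n A) u (n B))))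
    (countFin-cong (λ x → cong₂ glueAdj (splitAt-↑ʳ (n A) (n B) w) (splitAt-↑ʳ (n A) (n B) x))))

infixl 6 _⊔ᴳ_ _⋈_

_⊔ᴳ_ _⋈_ : Graph → Graph → Graph
A ⊔ᴳ B = glue A B (λ _ _ → false)
A ⋈ B = glue A B (λ _ _ → true)

degree-⊔ˡ : ∀ A B u → degree (A ⊔ᴳ B) (u ↑ˡ n B) ≡ degree A u
degree-⊔ˡ A B u = trans (degree-glueˡ A B _ u)
  (trans (cong (degree A u +_) (countFin-false (n B))) (+-identityʳ _))

degree-⊔ʳ : ∀ A B w → degree (A ⊔ᴳ B) (n A ↑ʳ w) ≡ degree B w
degree-⊔ʳ A B w = trans (degree-glueʳ A B _ w) (cong (_+ degree B w) (countFin-false (n A)))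

degree-⋈ˡ : ∀ A B u → degree (A ⋈ B) (u ↑ˡ n B) ≡ degree A u + n B
degree-⋈ˡ A B u = trans (degree-glueˡ A B _ u) (cong (degree A u +_) (countFin-true (n B)))

degree-⋈ʳ : ∀ A B w → degree (A ⋈ B) (n A ↑ʳ w) ≡ n A + degree B w
degree-⋈ʳ A B w = trans (degree-glueʳ A B _ w) (cong (_+ degree B w) (countFin-true (n A)))

-- Building blocks of the extremal graphs.

edgeless : ℕ → Graph
edgeless k = record
  { n = k ; adj = λ _ _ → false ; sym = λ _ _ → refl ; irrefl = λ _ → refl }

complete : ℕ → Graph
complete k = record
  { n = k ; adj = adjacent ; sym = adjacent-sym ; irrefl = adjacent-irrefl }
  where
  adjacent : ∀ {k} → Fin k → Fin k → Bool
  adjacent u v = not (does (u Fin.≟ v))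
  adjacent-sym : ∀ {k} (u v : Fin k) → adjacent u v ≡ adjacent v u
  adjacent-sym zero    zero    = refl
  adjacent-sym zero    (suc v) = refl
  adjacent-sym (suc u) zero    = refl
  adjacent-sym (suc u) (suc v) = adjacent-sym u v
  adjacent-irrefl : ∀ {k} (v : Fin k) → adjacent v v ≡ false
  adjacent-irrefl zero    = refl
  adjacent-irrefl (suc v) = adjacent-irrefl v

degree-complete : ∀ k v → degree (complete (suc k)) v ≡ k
degree-complete k v = trans (countFin≡∑ (suc k) (adj (complete (suc k)) v)) (go k v)
  where
  go : ∀ k (v : Fin (suc k)) → ∑ (suc k) (λ u → ind (not (does (v Fin.≟ u)))) ≡ k
  go k       zero    = trans (∑-const k 1) (*-identityʳ k)
  go (suc k) (suc v) = cong suc (go k v)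

-- The complete multipartite graph with `k` parts of size 2, as an iterated join. It supplies a
-- regular graph of even order in which each vertex misses only itself and its partner.
cocktailParty : ℕ → Graph
cocktailParty zero    = edgeless 0
cocktailParty (suc k) = edgeless 2 ⋈ cocktailParty k

n-cocktailParty : ∀ k → n (cocktailParty k) ≡ 2 * k
n-cocktailParty zero    = refl
n-cocktailParty (suc k) = trans (cong (2 +_) (n-cocktailParty k)) (≡.sym (*-suc 2 k))

degree-cocktailParty : ∀ k v → 2 + degree (cocktailParty k) v ≡ n (cocktailParty k)
degree-cocktailParty (suc k) = ∀-splitAt 2
  (λ u → cong (2 +_) (trans (degree-⋈ˡ (edgeless 2) (cocktailParty k) u)
                            (cong (_+ n (cocktailParty k)) (countFin-false 2))))
  (λ w → cong (2 +_) (trans (degree-⋈ʳ (edgeless 2) (cocktailParty k) w)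
                            (degree-cocktailParty k w)))

-- A graph of odd order 2k + 3 that is (2k + 1)-regular, except that vertex 0 misses one edge.
deficient : ℕ → Graph
deficient k = (complete 1 ⊔ᴳ complete 2) ⋈ cocktailParty k

n-deficient : ∀ k → Odd (n (deficient k))
n-deficient k = suc k , trans (cong (3 +_) (n-cocktailParty k)) (shift k)
  where
  shift : ∀ k → 3 + 2 * k ≡ suc (2 * suc k)
  shift = solve-∀

isZero : Fin k → Bool
isZero zero    = true
isZero (suc _) = false

isZero-↑ˡ : ∀ (u : Fin m) k → isZero (u ↑ˡ k) ≡ isZero u
isZero-↑ˡ zero    k = refl
isZero-↑ˡ (suc u) k = refl

isZero-unique : {u v : Fin k} → isZero u ≡ true → isZero v ≡ true → u ≡ v
isZero-unique {u = zero} {zero} _ _ = refl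

-- A single cross edge, placed at the two vertices `zero` because these are the ones that miss an
-- edge in the copies of `deficient`.
bridge : Fin m → Fin k → Bool
bridge u w = isZero u ∧ isZero w

countFin-bridgeˡ : ∀ k (u : Fin m) → countFin (suc k) (bridge u) ≡ ind (isZero u)
countFin-bridgeˡ {suc m} k zero =
  trans (countFin-split 1 {k} (bridge {m = suc m} zero)) (cong suc (countFin-false k))
countFin-bridgeˡ k (suc u) = countFin-false (suc k)

countFin-bridgeʳ : ∀ k (w : Fin m) → countFin (suc k) (λ u → bridge u w) ≡ ind (isZero w)
countFin-bridgeʳ k w = trans (countFin-split 1 {k} (λ u → bridge u w))
  (trans (cong (ind (isZero w) + 0 +_) (countFin-false k)) (trans (+-identityʳ _) (+-identityʳ _)))

degree-deficient : ∀ k v → degree (deficient k) v + ind (isZero v) ≡ suc (2 * k)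
degree-deficient k = ∀-splitAt 3 small
  (λ w → trans (+-identityʳ _) (trans (degree-⋈ʳ base C w)
           (cong suc (trans (degree-cocktailParty k w) (n-cocktailParty k)))))
  where
  base C : Graph
  base = complete 1 ⊔ᴳ complete 2
  C    = cocktailParty k
  base-degree : ∀ u → degree base u + ind (isZero u) ≡ 1
  base-degree zero             = refl
  base-degree (suc zero)       = refl
  base-degree (suc (suc zero)) = refl
  small : ∀ u → degree (deficient k) (u ↑ˡ n C) + ind (isZero (u ↑ˡ n C)) ≡ suc (2 * k)
  small u = begin
    degree (deficient k) (u ↑ˡ n C) + ind (isZero (u ↑ˡ n C))
      ≡⟨ cong₂ (λ x b → x + ind b) (degree-⋈ˡ base C u) (isZero-↑ˡ u (n C)) ⟩
    degree base u + n C + ind (isZero u)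
      ≡⟨ swap₃ (degree base u) (n C) (ind (isZero u)) ⟩
    (degree base u + ind (isZero u)) + n C
      ≡⟨ cong₂ _+_ (base-degree u) (n-cocktailParty k) ⟩
    suc (2 * k) ∎
    where
    open ≡.≡-Reasoning
    swap₃ : ∀ x y z → x + y + z ≡ x + z + y
    swap₃ = solve-∀

-- The extremal graphs.

-- Collects what the argument uses, so that both parities of `d` can be treated alike afterwards.
-- All degrees are taken in the glued graph, and `cross-unique` allows one cross edge or none.
record Extremal (d s : ℕ) : Set where
  field
    A B           : Graph
    cross         : Fin (n A) → Fin (n B) → Bool
    oddOrder      : Odd (n A)
    cross-unique  : ∀ {u u′ w w′} → cross u w ≡ true → cross u′ w′ ≡ true → u ≡ u′ × w ≡ w′
    degreeˡ       : ∀ u → degree (glue A B cross) (u ↑ˡ n B) ≡ d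
    degreeʳ       : ∀ w → d ≤ degree (glue A B cross) (n A ↑ʳ w)
                        × degree (glue A B cross) (n A ↑ʳ w) ≤ d + s
    top           : Fin (n B)
    degree-top    : degree (glue A B cross) (n A ↑ʳ top) ≡ d + s

  whole : Graph
  whole = glue A B cross

  bottom : Fin (n A)
  -- An odd order is a successor, so `A` has a vertex.
  bottom = subst Fin (≡.sym (proj₂ oddOrder)) zero

within-≡ : ∀ {x d} s → x ≡ d → d ≤ x × x ≤ d + s
within-≡ s refl = ≤-refl , m≤m+n _ s

within-top : ∀ {x d} s → x ≡ d + s → d ≤ x × x ≤ d + s
within-top {d = d} s refl = m≤m+n d s , ≤-refl

extremal-even : ∀ k s → Extremal (2 * k) s
extremal-even k s = record
  { A = A ; B = B ; cross = λ _ _ → false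
  ; oddOrder = k , refl
  ; cross-unique = λ ()
  ; degreeˡ = λ u → trans (degree-⊔ˡ A B u) (degree-complete d u)
  ; degreeʳ = λ w → within-top s (degʳ w)
  ; top = zero
  ; degree-top = degʳ zero
  }
  where
  d : ℕ
  d = 2 * k
  A B : Graph
  A = complete (suc d)
  B = complete (suc (d + s))
  degʳ : ∀ w → degree (A ⊔ᴳ B) (n A ↑ʳ w) ≡ d + s
  degʳ w = trans (degree-⊔ʳ A B w) (degree-complete (d + s) w)

-- For odd `d` no `d`-regular graph has odd order, so `A` cannot be a component. The bridge supplies
-- the missing edge at vertex `zero` of `A`, and of the second copy inside `B` at the same time.
extremal-odd : ∀ k s → Extremal (suc (2 * k)) s
extremal-odd k s = record
  { A = A ; B = B ; cross = bridge
  ; oddOrder = n-deficient k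
  ; cross-unique = unique
  ; degreeˡ = λ u → trans (degree-glueˡ A B bridge u)
      -- The explicit number is the order of `B` minus one, since `countFin-bridgeˡ` counts over
      -- `Fin (suc k)`.
      (trans (cong (degree A u +_) (countFin-bridgeˡ (2 + n (cocktailParty k) + n K) u)) (degree-deficient k u))
  ; degreeʳ = ∀-splitAt (n A) (within-≡ s ∘ degʳˡ) (within-top s ∘ degʳʳ)
  ; top = n A ↑ʳ zero
  ; degree-top = degʳʳ zero
  }
  where
  d : ℕ
  d = suc (2 * k)
  A K B : Graph
  A = deficient k
  K = complete (suc (d + s))
  B = A ⊔ᴳ K
  unique : ∀ {u u′ : Fin (n A)} {w w′ : Fin (n B)} →
           bridge u w ≡ true → bridge u′ w′ ≡ true → u ≡ u′ × w ≡ w′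
  unique {zero} {zero} p q = refl , isZero-unique p q
  degʳˡ : ∀ w → degree (glue A B bridge) (n A ↑ʳ (w ↑ˡ n K)) ≡ d
  degʳˡ w = begin
    degree (glue A B bridge) (n A ↑ʳ (w ↑ˡ n K))
      ≡⟨ degree-glueʳ A B bridge (w ↑ˡ n K) ⟩
    countFin (n A) (λ u → bridge u (w ↑ˡ n K)) + degree B (w ↑ˡ n K)
      ≡⟨ cong₂ _+_ (countFin-bridgeʳ (2 + n (cocktailParty k)) (w ↑ˡ n K)) (degree-⊔ˡ A K w) ⟩
    ind (isZero (w ↑ˡ n K)) + degree A w
      ≡⟨ cong (λ b → ind b + degree A w) (isZero-↑ˡ w (n K)) ⟩
    ind (isZero w) + degree A w
      ≡⟨ +-comm (ind (isZero w)) _ ⟩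
    degree A w + ind (isZero w)
      ≡⟨ degree-deficient k w ⟩
    d ∎
    where open ≡.≡-Reasoning
  degʳʳ : ∀ w → degree (glue A B bridge) (n A ↑ʳ (n A ↑ʳ w)) ≡ d + s
  degʳʳ w = trans (degree-glueʳ A B bridge (n A ↑ʳ w))
    (trans (cong₂ _+_ (countFin-bridgeʳ (2 + n (cocktailParty k)) (n A ↑ʳ w)) (degree-⊔ʳ A K w)) (degree-complete (d + s) w))

extremal : ∀ d s → Extremal d s
extremal d s with parity d
  where
  parity : ∀ d → (∃[ k ] d ≡ 2 * k) ⊎ Odd d
  parity zero = inj₁ (0 , refl)
  parity (suc d) with parity d
  ... | inj₁ (k , refl) = inj₂ (k , refl)
  ... | inj₂ (k , refl) = inj₁ (suc k , ≡.sym (*-suc 2 k))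
... | inj₁ (k , refl) = extremal-even k s
... | inj₂ (k , refl) = extremal-odd k s

-- Colour classes and their degrees.

-- This is the predicate counted by `factorDegree`, so `factorDegree G χ i v` unfolds to a count of
-- it.
hasColour : (G : Graph) {x : ℕ} → EdgeColouring G x → Fin x → Fin (n G) → Fin (n G) → Bool
hasColour G χ i u v = if adj G u v then does (col χ u v Fin.≟ i) else false

hasColour-sym : ∀ G {x} (χ : EdgeColouring G x) i u v → hasColour G χ i u v ≡ hasColour G χ i v u
hasColour-sym G χ i u v with adj G u v in uv | adj G v u in vu
... | true  | true  = cong (λ c → does (c Fin.≟ i)) (colSym χ u v uv)
... | false | false = refl
... | true  | false = contradiction (trans (≡.sym uv) (trans (Graph.sym G u v) vu)) λ ()
... | false | true  = contradiction (trans (≡.sym uv) (trans (Graph.sym G u v) vu)) λ ()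

hasColour-irrefl : ∀ G {x} (χ : EdgeColouring G x) i v → hasColour G χ i v v ≡ false
hasColour-irrefl G χ i v rewrite Graph.irrefl G v = refl

-- Double counting: after exchanging the sums, each edge at `v` is counted once, namely for its own
-- colour.
∑-factorDegree : ∀ G {x} (χ : EdgeColouring G x) v → ∑ x (λ i → factorDegree G χ i v) ≡ degree G v
∑-factorDegree G {x} χ v = begin
  ∑ x (λ i → factorDegree G χ i v)
    ≡⟨ ∑-cong (λ i → countFin≡∑ (n G) (hasColour G χ i v)) ⟩
  ∑ x (λ i → ∑ (n G) (λ u → ind (hasColour G χ i v u)))
    ≡⟨ ∑-comm +-0-commutativeMonoid (λ i u → ind (hasColour G χ i v u)) ⟩
  ∑ (n G) (λ u → ∑ x (λ i → ind (hasColour G χ i v u)))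
    ≡⟨ ∑-cong (λ u → colours (adj G v u) (col χ v u)) ⟩
  ∑ (n G) (λ u → ind (adj G v u))
    ≡⟨ countFin≡∑ (n G) (adj G v) ⟨
  degree G v ∎
  where
  open ≡.≡-Reasoning
  ∑-does : ∀ {x} (c : Fin x) → ∑ x (λ i → ind (does (c Fin.≟ i))) ≡ 1
  ∑-does {suc x} zero    = cong suc (trans (∑-const x 0) (*-zeroʳ x))
  ∑-does {suc x} (suc c) = ∑-does c
  colours : ∀ b (c : Fin x) → ∑ x (λ i → ind (if b then does (c Fin.≟ i) else false)) ≡ ind b
  colours true  c = ∑-does c
  colours false c = trans (∑-const x 0) (*-zeroʳ x)

module _ {r a : ℕ} (G : Graph) {x : ℕ} (χ : EdgeColouring G x) (fac : IsFactorization r a G χ) where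

  factorization-lower : ∀ v → x * r ≤ degree G v
  factorization-lower v = begin
    x * r                            ≡⟨ ∑-const x r ⟨
    ∑ x (const r)                    ≤⟨ ∑-mono (λ i → proj₁ (fac i v)) ⟩
    ∑ x (λ i → factorDegree G χ i v) ≡⟨ ∑-factorDegree G χ v ⟩
    degree G v                       ∎
    where open ≤-Reasoning

  factorization-upper : ∀ v → degree G v ≤ x * (r + a)
  factorization-upper v = begin
    degree G v                       ≡⟨ ∑-factorDegree G χ v ⟨
    ∑ x (λ i → factorDegree G χ i v) ≤⟨ ∑-mono (λ i → proj₂ (fac i v)) ⟩
    ∑ x (const (r + a))              ≡⟨ ∑-const x (r + a) ⟩
    x * (r + a)                      ∎
    where open ≤-Reasoning

  factorization-tight : ∀ v → degree G v ≡ x * r → ∀ i → factorDegree G χ i v ≡ r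
  factorization-tight v deg = ∑-tight r (λ i → proj₁ (fac i v))
    (≤-reflexive (trans (∑-factorDegree G χ v) deg))

-- Parity against tight factorizations.

-- Otherwise the colour class restricted to A would be r-regular of odd order.
cross-edge-colour : ∀ A B c {x r} (χ : EdgeColouring (glue A B c) x) (i : Fin x) →
  Odd (n A) → Odd r → (∀ u → factorDegree (glue A B c) χ i (u ↑ˡ n B) ≡ r) →
  ¬ (∀ u w → c u w ≡ true → col χ (u ↑ˡ n B) (n A ↑ʳ w) ≢ i)
cross-edge-colour A B c {x} {r} χ i oddA oddr deg none =
  [ ¬2∣odd oddA , ¬2∣odd oddr ]′ (euclidsLemma (n A) r prime[2] (subst (2 ∣_) total
    (handshake (n A) inner (λ u v → hasColour-sym G χ i (u ↑ˡ n B) (v ↑ˡ n B))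
                           (λ v → hasColour-irrefl G χ i (v ↑ˡ n B)))))
  where
  open ≡.≡-Reasoning
  G : Graph
  G = glue A B c
  inner : Fin (n A) → Fin (n A) → Bool
  inner u v = hasColour G χ i (u ↑ˡ n B) (v ↑ˡ n B)
  outer : ∀ u w → hasColour G χ i (u ↑ˡ n B) (n A ↑ʳ w) ≡ false
  outer u w rewrite glue-crossʳ A B c u w with c u w in cuw
  ... | false = refl
  ... | true with col χ (u ↑ˡ n B) (n A ↑ʳ w) Fin.≟ i
  ...   | yes eq = contradiction eq (none u w cuw)
  ...   | no _   = refl
  row : ∀ u → ∑ (n A) (λ v → ind (inner u v)) ≡ r
  row u = begin
    ∑ (n A) (λ v → ind (inner u v))
      ≡⟨ countFin≡∑ (n A) (inner u) ⟨
    countFin (n A) (inner u)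
      ≡⟨ +-identityʳ _ ⟨
    countFin (n A) (inner u) + 0
      ≡⟨ cong (countFin (n A) (inner u) +_) (trans (countFin-cong (outer u)) (countFin-false (n B))) ⟨
    countFin (n A) (inner u) + countFin (n B) (λ w → hasColour G χ i (u ↑ˡ n B) (n A ↑ʳ w))
      ≡⟨ countFin-split (n A) (hasColour G χ i (u ↑ˡ n B)) ⟨
    factorDegree G χ i (u ↑ˡ n B)
      ≡⟨ deg u ⟩
    r ∎
  total : ∑ (n A) (λ u → ∑ (n A) (λ v → ind (inner u v))) ≡ n A * r
  total = trans (∑-cong row) (∑-const (n A) r)

-- Each of two different colours needs a cross edge, but there is at most one cross edge and it has
-- only one colour.
no-tight-factorization : ∀ {r a s x} → Odd r → 2 ≤ x → (E : Extremal (x * r) s) →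
                         ¬ HasFactorization r a (Extremal.whole E) x
no-tight-factorization {r} oddr (s≤s (s≤s _)) E (χ , fac) =
  -- `uses` only refutes the absence of a cross edge of the given colour. Since the goal is a
  -- contradiction, it can be applied twice in a nested way, each time handing over such an edge.
  uses zero λ u w cuw is0 → uses (suc zero) λ u′ w′ cuw′ is1 →
    distinct (cross-unique cuw cuw′) is0 is1
  where
  open Extremal E
  uses : ∀ i → ¬ (∀ u w → cross u w ≡ true → col χ (u ↑ˡ n B) (n A ↑ʳ w) ≢ i)
  uses i = cross-edge-colour A B cross χ i oddOrder oddr
    (λ u → factorization-tight whole χ fac (u ↑ˡ n B) (degreeˡ u) i)
  distinct : ∀ {u u′ w w′} → u ≡ u′ × w ≡ w′ → col χ (u ↑ˡ n B) (n A ↑ʳ w) ≡ zero →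
             col χ (u′ ↑ˡ n B) (n A ↑ʳ w′) ≢ suc zero
  distinct (refl , refl) is0 is1 = contradiction (trans (≡.sym is0) is1) λ ()

-- Ceilings and the possible numbers of factors.

ceilDiv-least : ∀ p a x → p ≤ x * suc a → ceilDiv p (suc a) ≤ x
ceilDiv-least p a x p≤ = ≤-pred (m<n*o⇒m/o<n {p + a} {suc x} {suc a} (begin-strict
  p + a             ≤⟨ +-monoˡ-≤ a p≤ ⟩
  x * suc a + a     <⟨ +-monoʳ-< (x * suc a) (n<1+n a) ⟩
  x * suc a + suc a ≡⟨ +-comm (x * suc a) (suc a) ⟩
  suc x * suc a     ∎))
  where open ≤-Reasoning

ceilDiv-upper : ∀ p a → p ≤ ceilDiv p (suc a) * suc a
ceilDiv-upper p a = +-cancelʳ-≤ a p _ (begin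
  p + a                                       ≡⟨ m≡m%n+[m/n]*n (p + a) (suc a) ⟩
  -- The remainder is at most `a`, exactly the amount added before dividing.
  (p + a) % suc a + ceilDiv p (suc a) * suc a ≤⟨ +-monoˡ-≤ _ (≤-pred (m%n<n (p + a) (suc a))) ⟩
  a + ceilDiv p (suc a) * suc a               ≡⟨ +-comm a _ ⟩
  ceilDiv p (suc a) * suc a + a               ∎)
  where open ≤-Reasoning

-- Pigeonhole: shifted down by `q`, the `suc t` values lie in `Fin t`.
no-injection-into-interval : ∀ {t} q (f : Fin (suc t) → ℕ) → (∀ j → q ≤ f j) → (∀ j → f j < q + t) →
                             ¬ Injective _≡_ _≡_ f
no-injection-into-interval {t} q f q≤f f<q+t f-inj = Fin.<⇒notInjective {f = g} (n<1+n t) g-inj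
  where
  bound : ∀ j → f j ∸ q < t
  bound j = subst (f j ∸ q <_) (m+n∸m≡n q t) (∸-monoˡ-< (f<q+t j) (q≤f j))
  g : Fin (suc t) → Fin t
  g j = fromℕ< (bound j)
  g-inj : Injective _≡_ _≡_ g
  g-inj {i} {j} gi≡gj = f-inj (∸-cancelʳ-≡ (q≤f i) (q≤f j) (begin
    f i ∸ q        ≡⟨ toℕ-fromℕ< (bound i) ⟨
    Fin.toℕ (g i)  ≡⟨ cong Fin.toℕ gi≡gj ⟩
    Fin.toℕ (g j)  ≡⟨ toℕ-fromℕ< (bound j) ⟩
    f j ∸ q        ∎))
    where open ≡.≡-Reasoning

-- The degree bounds at `bottom` and `top` confine the number of factors to `q`, ..., `q + t`.
-- Parity removes the last value, so only `t` remain for `suc t` factorizations. Here `q` stands for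
-- the ceiling, through its minimality `least`.
extremal-not-many : ∀ {r a t s} q → let x = q + t in Odd r → Odd a → 2 ≤ x →
  (∀ y → r * suc t + s ≤ y * a → q ≤ y) →
  (E : Extremal (x * r) s) → ¬ ManyFactorizations r a (suc t) (Extremal.whole E)
-- Matching on the oddness of `r` exposes it as a successor, which cancelling the factor `r` in
-- `upper` requires.
extremal-not-many {r} {a} {t} {s} q oddr@(h , refl) odda 2≤x least E (f , f-inj , facs) =
  no-injection-into-interval q f lower
    (λ j → ≤∧≢⇒< (upper j) (λ eq → no-tight-factorization oddr 2≤x E
      (subst (HasFactorization r a whole) eq (facs j))))
    f-inj
  where
  open Extremal E
  open ≤-Reasoning
  upper : ∀ j → f j ≤ q + t
  upper j = *-cancelʳ-≤ (f j) (q + t) r (begin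
    f j * r                    ≤⟨ factorization-lower whole (proj₁ (facs j)) (proj₂ (facs j)) _ ⟩
    degree whole (bottom ↑ˡ _) ≡⟨ degreeˡ bottom ⟩
    (q + t) * r                ∎)
  rearrange : ∀ y t r s → y * r + (r * suc t + s) ≡ (suc y + t) * r + s
  rearrange = solve-∀
  lower : ∀ j → q ≤ f j
  lower j with f j | facs j
  ... | y | χ , fac with q ≤? y
  ...   | yes q≤y = q≤y
  -- If `y < q`, then `suc y + t` is at most `q + t`. The degree of `top` then yields the hypothesis
  -- of `least`, which returns the goal itself.
  ...   | no  q≰y = least y (+-cancelˡ-≤ (y * r) _ _ (begin
    y * r + (r * suc t + s) ≡⟨ rearrange y t r s ⟩
    (suc y + t) * r + s     ≤⟨ +-monoˡ-≤ s (*-monoˡ-≤ r (+-monoˡ-≤ t (≰⇒> q≰y))) ⟩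
    (q + t) * r + s         ≡⟨ degree-top ⟨
    degree whole (_ ↑ʳ top) ≤⟨ factorization-upper whole χ fac _ ⟩
    y * (r + a)             ≡⟨ *-distribˡ-+ y r a ⟩
    y * r + y * a           ∎))

extremal-degrees : ∀ {d s} (E : Extremal d s) → IsDDSGraph d s (Extremal.whole E)
extremal-degrees {s = s} E = ∀-splitAt (n (Extremal.A E)) (within-≡ s ∘ degreeˡ) degreeʳ
  where open Extremal E

-- Secures the two colours that compete for the cross edge. A positive numerator makes the ceiling
-- at least 1, which suffices when `t` is positive; for `t = 0` the hypothesis `a < r + s` makes it
-- at least 2.
2≤ceilDiv+t : ∀ r a t s → Odd r → Odd a → (2 ≤ suc t) ⊎ (suc t ≡ 1 × a < suc t * r + s) →
              2 ≤ ceilDiv (r * suc t + s) a + t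
2≤ceilDiv+t r a (suc t) s (h , refl) (b , refl) _ = +-mono-≤ 1≤q (s≤s z≤n)
  where
  1≤q : 1 ≤ ceilDiv (r * suc (suc t) + s) a
  1≤q = n≢0⇒n>0 λ q≡0 → contradiction
    -- A zero ceiling would bound the positive numerator by 0.
    (subst (λ q → r * suc (suc t) + s ≤ q * a) q≡0 (ceilDiv-upper _ (2 * b))) λ ()
2≤ceilDiv+t r a zero s _ (b , refl) (inj₂ (_ , a<)) = ≤-trans 2≤q (m≤m+n _ 0)
  where
  open ≤-Reasoning
  2≤q : 2 ≤ ceilDiv (r * 1 + s) a
  2≤q = *-cancelʳ-< a 1 _ (begin-strict
    1 * a                       ≡⟨ *-identityˡ a ⟩
    a                           <⟨ a< ⟩
    1 * r + s                   ≡⟨ cong (_+ s) (*-comm 1 r) ⟩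
    r * 1 + s                   ≤⟨ ceilDiv-upper (r * 1 + s) (2 * b) ⟩
    ceilDiv (r * 1 + s) a * a   ∎)
2≤ceilDiv+t r a zero s _ _ (inj₁ (s≤s ()))

-- The two lower bounds for the threshold.

sigma-lower : ∀ r a t s → Odd r → Odd a → (2 ≤ suc t) ⊎ (suc t ≡ 1 × a < suc t * r + s) →
              SigmaAtLeast r s a (suc t) (r * ceilDiv (r * suc t + s) a + t * r + 1)
sigma-lower r a t s oddr odda@(b , refl) hyp D thr = ≮⇒≥ λ D< →
  extremal-not-many q oddr odda (2≤ceilDiv+t r a t s oddr odda hyp)
    (ceilDiv-least _ (2 * b)) E
    -- The claimed bound is the successor of `(q + t) * r`, so a smaller `D` would cover the
    -- extremal graph with this minimum degree.
    (thr ((q + t) * r) (≤-pred (subst (D <_) (bound q r t) D<)) _ (extremal-degrees E))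
  where
  q : ℕ
  q = ceilDiv (r * suc t + s) a
  E : Extremal ((q + t) * r) s
  E = extremal ((q + t) * r) s
  bound : ∀ q r t → r * q + t * r + 1 ≡ suc ((q + t) * r)
  bound = solve-∀

-- The complete graph on `r` vertices has all degrees `r - 1`, too small for even one factor.
sigma-lower₁ : ∀ r a s → Odd r → SigmaAtLeast r s a 1 r
sigma-lower₁ r a s (h , refl) D thr = ≮⇒≥ λ D<r →
  no-factorization (thr (2 * h) (≤-pred D<r) (complete r) (within-≡ s ∘ degree-complete (2 * h)))
  where
  no-factorization : ¬ ManyFactorizations r a 1 (complete r)
  no-factorization (f , _ , facs) with f zero | facs zero
  -- `col` assigns a colour to every pair of vertices, adjacent or not, so zero colours are
  -- impossible once there is a vertex.
  ... | zero  | χ , _ with () ← col χ zero zero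
  ... | suc x | χ , fac = <⇒≱ (n<1+n (2 * h)) (begin
    r                          ≤⟨ m≤m+n r (x * r) ⟩
    suc x * r                  ≤⟨ factorization-lower (complete r) χ fac zero ⟩
    degree (complete r) zero   ≡⟨ degree-complete (2 * h) zero ⟩
    2 * h                      ∎)
    where open ≤-Reasoning

theorem27 : (r a t s : ℕ) → Odd r → Odd a → 1 ≤ t →
    (((2 ≤ t) ⊎ (t ≡ 1 × a < t * r + s)) →
    SigmaAtLeast r s a t (r * ceilDiv (r * t + s) a + (t ∸ 1) * r + 1))
    × ((t ≡ 1 × r + s ≤ a) → SigmaAtLeast r s a t r)
theorem27 r a (suc t) s oddr odda _ =
    sigma-lower r a t s oddr odda
  , λ { (refl , _) → sigma-lower₁ r a s oddr }
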